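{- Let $\gamma\ge 0$, let $f:2^{[n]}\to\mathbb{R}$ be a set function and let $F:[0,1]^n\to\mathbb{R}$ be its multilinear extension. If $F$ is one-sided $(\gamma/2)$-smooth, then $f$ is $\gamma$-meta-submodular.
   Context: $[n]=\{1,\dots,n\}$; $S+i=S\cup\{i\}$, $S-i=S\setminus\{i\}$ (operations applied from left to right). For a set function $f$ on $2^{[n]}$, define $B_i(S)=f(S+i)-f(S-i)$ and $A_{ij}(S)=B_j(S+i)-B_j(S-i)=f(S+i+j)-f(S+i-j)-f(S-i+j)+f(S-i-j)$ (so $A_{ii}(S)=0$). For $\gamma\ge 0$, $f$ is $\gamma$-meta-submodular if for every nonempty $S\subseteq[n]$ and all $i,j\in[n]$, $A_{ij}(S)\le\gamma\,\frac{B_i(S)+B_j(S)}{|S|}$. The multilinear extension is $F(x)=\sum_{R\subseteq[n]} f(R)\prod_{v\in R}x_v\prod_{v\in[n]\setminus R}(1-x_v)$. A twice continuously differentiable $F:[0,1]^n\to\mathbb{R}$ is one-sided $\sigma$-smooth at $x\ne\vec 0$ if for every $u\in[0,1]^n$, $\frac12 u^\top\nabla^2F(x)u\le\sigma\,\frac{\|u\|_1}{\|x\|_1}\,u^\top\nabla F(x)$; $F$ is one-sided $\sigma$-smooth if this holds at every non-zero $x\in[0,1]^n$. -}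

module Defs where

open import Algebra.Bundles.Raw using (RawMonoid)
open import Data.Fin.Base using (Fin; zero; suc)
open import Data.Fin.Subset as Subset
  using (Subset; inside; outside; ⁅_⁆; _∪_; ∁; Nonempty)
open import Data.Fin.Subset.Properties using (x∈p⇒∣p-x∣<∣p∣)
open import Data.Integer.Base using (+_)
open import Data.Nat.Base as ℕ using (ℕ)
import Data.Nat.Properties as ℕₚ
open import Data.Product.Base using (Σ-syntax; ∃; ∃-syntax; _×_; _,_; proj₁; proj₂)
open import Data.Rational.Base as ℚ using (ℚ; 0ℚ; 1ℚ)
import Data.Rational.Properties as ℚₚ
open import Data.Rational.Solver using (module +-*-Solver)
open import Data.Sum.Base using (inj₁; inj₂)
open import Data.Vec.Base using ([]; _∷_)
open import Level using (0ℓ)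
open import Relation.Binary.PropositionalEquality
  using (_≡_; _≢_; refl; sym; trans; cong; cong₂; subst)
open import Relation.Nullary using (yes; no; contradiction)

private
  variable
    n : ℕ

------------------------------------------------------------------------
-- Rational estimates

½ε+½ε≡ε : ∀ ε → ℚ.½ ℚ.* ε ℚ.+ ℚ.½ ℚ.* ε ≡ ε
½ε+½ε≡ε ε = trans (sym (ℚₚ.*-distribʳ-+ ε ℚ.½ ℚ.½)) (ℚₚ.*-identityˡ ε)

0<pq : ∀ {p q} → 0ℚ ℚ.< p → 0ℚ ℚ.< q → 0ℚ ℚ.< p ℚ.* q
0<pq {p} {q} 0<p 0<q =
  ℚₚ.positive⁻¹ _ {{ℚₚ.pos*pos⇒pos p {{ℚ.positive 0<p}} q {{ℚ.positive 0<q}}}}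

0<½ε : ∀ {ε} → 0ℚ ℚ.< ε → 0ℚ ℚ.< ℚ.½ ℚ.* ε
0<½ε = 0<pq (ℚₚ.positive⁻¹ ℚ.½)

*-mono-≤-nonNeg : ∀ {p q r s} → 0ℚ ℚ.≤ r → 0ℚ ℚ.≤ q →
                  p ℚ.≤ q → r ℚ.≤ s → p ℚ.* r ℚ.≤ q ℚ.* s
*-mono-≤-nonNeg {p} {q} {r} {s} 0≤r 0≤q p≤q r≤s = ℚₚ.≤-trans
  (ℚₚ.*-monoʳ-≤-nonNeg r {{ℚ.nonNegative 0≤r}} p≤q)
  (ℚₚ.*-monoˡ-≤-nonNeg q {{ℚ.nonNegative 0≤q}} r≤s)

∣p-q∣≡∣q-p∣ : ∀ p q → ℚ.∣ p ℚ.- q ∣ ≡ ℚ.∣ q ℚ.- p ∣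
∣p-q∣≡∣q-p∣ p q = trans (sym (ℚₚ.∣-p∣≡∣p∣ (p ℚ.- q)))
  (cong ℚ.∣_∣ (solve 2 (λ a b → :- (a :- b) := b :- a) refl p q))
  where open +-*-Solver

∣p∣≤∣q∣+∣p-q∣ : ∀ p q → ℚ.∣ p ∣ ℚ.≤ ℚ.∣ q ∣ ℚ.+ ℚ.∣ p ℚ.- q ∣
∣p∣≤∣q∣+∣p-q∣ p q = ℚₚ.≤-trans
  (ℚₚ.≤-reflexive (cong ℚ.∣_∣ (solve 2 (λ a b → a := b :+ (a :- b)) refl p q)))
  (ℚₚ.∣p+q∣≤∣p∣+∣q∣ q (p ℚ.- q))
  where open +-*-Solver

∣p∣-∣q∣≤∣p-q∣ : ∀ p q → ℚ.∣ p ∣ ℚ.- ℚ.∣ q ∣ ℚ.≤ ℚ.∣ p ℚ.- q ∣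
∣p∣-∣q∣≤∣p-q∣ p q = ℚₚ.≤-trans
  (ℚₚ.+-monoˡ-≤ (ℚ.- ℚ.∣ q ∣) (∣p∣≤∣q∣+∣p-q∣ p q))
  (ℚₚ.≤-reflexive
    (solve 2 (λ a b → (b :+ a) :- b := a) refl ℚ.∣ p ℚ.- q ∣ ℚ.∣ q ∣))
  where open +-*-Solver

∣∣p∣-∣q∣∣≤∣p-q∣ : ∀ p q → ℚ.∣ ℚ.∣ p ∣ ℚ.- ℚ.∣ q ∣ ∣ ℚ.≤ ℚ.∣ p ℚ.- q ∣
∣∣p∣-∣q∣∣≤∣p-q∣ p q with ℚₚ.∣p∣≡p∨∣p∣≡-p (ℚ.∣ p ∣ ℚ.- ℚ.∣ q ∣)
... | inj₁ eq = ℚₚ.≤-trans (ℚₚ.≤-reflexive eq) (∣p∣-∣q∣≤∣p-q∣ p q)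
... | inj₂ eq = ℚₚ.≤-trans
  (ℚₚ.≤-reflexive (trans eq (solve 2 (λ a b → :- (a :- b) := b :- a) refl ℚ.∣ p ∣ ℚ.∣ q ∣)))
  (ℚₚ.≤-trans (∣p∣-∣q∣≤∣p-q∣ q p) (ℚₚ.≤-reflexive (∣p-q∣≡∣q-p∣ q p)))
  where open +-*-Solver

-- Totalised by inv 0 = 0, so that the sequence underlying recip below does not
-- depend on the proof of apartness from 0.
inv : ℚ → ℚ
inv q with q ℚₚ.≟ 0ℚ
... | yes _   = 0ℚ
... | no  q≢0 = (ℚ.1/ q) {{ℚ.≢-nonZero q≢0}}

*-invʳ : ∀ q → q ≢ 0ℚ → q ℚ.* inv q ≡ 1ℚ
*-invʳ q q≢0 with q ℚₚ.≟ 0ℚ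
... | yes q≡0 = contradiction q≡0 q≢0
... | no  q≢0 = ℚₚ.*-inverseʳ q {{ℚ.≢-nonZero q≢0}}

------------------------------------------------------------------------
-- Real numbers as Cauchy sequences of rationals

Cauchy : (ℕ → ℚ) → Set
Cauchy u = ∀ ε → 0ℚ ℚ.< ε →
  ∃[ N ] ∀ j k → N ℕ.≤ j → N ℕ.≤ k → ℚ.∣ u j ℚ.- u k ∣ ℚ.≤ ε

record ℝ : Set where
  constructor mkℝ
  field
    seq    : ℕ → ℚ
    cauchy : Cauchy seq

open ℝ public

Eventually : (ℕ → Set) → Set
Eventually P = ∃[ N ] ∀ k → N ℕ.≤ k → P k

infix 4 _≈_ _≤_ _<_ _#_

_≈_ _≤_ _<_ _#_ : ℝ → ℝ → Set
x ≈ y = ∀ ε → 0ℚ ℚ.< ε → Eventually λ k → ℚ.∣ seq x k ℚ.- seq y k ∣ ℚ.≤ ε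
x ≤ y = ∀ ε → 0ℚ ℚ.< ε → Eventually λ k → seq x k ℚ.≤ seq y k ℚ.+ ε
x < y = ∃[ ε ] 0ℚ ℚ.< ε × Eventually λ k → seq x k ℚ.+ ε ℚ.≤ seq y k
x # y = ∃[ ε ] 0ℚ ℚ.< ε × Eventually λ k → ε ℚ.≤ ℚ.∣ seq x k ℚ.- seq y k ∣

fromℚ : ℚ → ℝ
fromℚ q = mkℝ (λ _ → q) λ ε 0<ε → 0 , λ _ _ _ _ →
  subst (λ t → ℚ.∣ t ∣ ℚ.≤ ε) (sym (ℚₚ.+-inverseʳ q)) (ℚₚ.<⇒≤ 0<ε)

fromℕ : ℕ → ℝ
fromℕ k = fromℚ (+ k ℚ./ 1)

0ℝ 1ℝ ½ : ℝ
0ℝ = fromℚ 0ℚ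
1ℝ = fromℚ 1ℚ
½  = fromℚ ℚ.½

infixl 6 _+_ _-_
infixl 7 _*_
infix  8 -_

_+_ : ℝ → ℝ → ℝ
x + y = mkℝ (λ k → seq x k ℚ.+ seq y k) λ ε 0<ε →
  let N , p = cauchy x (ℚ.½ ℚ.* ε) (0<½ε 0<ε)
      M , q = cauchy y (ℚ.½ ℚ.* ε) (0<½ε 0<ε)
  in N ℕ.⊔ M , λ j k N⊔M≤j N⊔M≤k → begin
    ℚ.∣ (seq x j ℚ.+ seq y j) ℚ.- (seq x k ℚ.+ seq y k) ∣
      ≡⟨ cong ℚ.∣_∣ (solve 4 (λ a b c d → (a :+ b) :- (c :+ d) := (a :- c) :+ (b :- d))
           refl (seq x j) (seq y j) (seq x k) (seq y k)) ⟩
    ℚ.∣ (seq x j ℚ.- seq x k) ℚ.+ (seq y j ℚ.- seq y k) ∣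
      ≤⟨ ℚₚ.∣p+q∣≤∣p∣+∣q∣ (seq x j ℚ.- seq x k) (seq y j ℚ.- seq y k) ⟩
    ℚ.∣ seq x j ℚ.- seq x k ∣ ℚ.+ ℚ.∣ seq y j ℚ.- seq y k ∣
      ≤⟨ ℚₚ.+-mono-≤
           (p j k (ℕₚ.m⊔n≤o⇒m≤o N M N⊔M≤j) (ℕₚ.m⊔n≤o⇒m≤o N M N⊔M≤k))
           (q j k (ℕₚ.m⊔n≤o⇒n≤o N M N⊔M≤j) (ℕₚ.m⊔n≤o⇒n≤o N M N⊔M≤k)) ⟩
    ℚ.½ ℚ.* ε ℚ.+ ℚ.½ ℚ.* ε
      ≡⟨ ½ε+½ε≡ε ε ⟩
    ε ∎
  where
  open ℚₚ.≤-Reasoning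
  open +-*-Solver

-_ : ℝ → ℝ
- x = mkℝ (λ k → ℚ.- seq x k) λ ε 0<ε →
  let N , p = cauchy x ε 0<ε
  in N , λ j k N≤j N≤k → subst (ℚ._≤ ε)
    (trans (sym (ℚₚ.∣-p∣≡∣p∣ (seq x j ℚ.- seq x k)))
           (cong ℚ.∣_∣ (ℚₚ.neg-distrib-+ (seq x j) (ℚ.- seq x k))))
    (p j k N≤j N≤k)

_-_ : ℝ → ℝ → ℝ
x - y = x + (- y)

∣_∣ : ℝ → ℝ
∣ x ∣ = mkℝ (λ k → ℚ.∣ seq x k ∣) λ ε 0<ε →
  let N , p = cauchy x ε 0<ε
  in N , λ j k N≤j N≤k →
    ℚₚ.≤-trans (∣∣p∣-∣q∣∣≤∣p-q∣ (seq x j) (seq x k)) (p j k N≤j N≤k)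

bounded : ∀ x → ∃[ K ] 0ℚ ℚ.< K × Eventually λ k → ℚ.∣ seq x k ∣ ℚ.≤ K
bounded x =
  let N , p = cauchy x 1ℚ (ℚₚ.positive⁻¹ 1ℚ)
  in ℚ.∣ seq x N ∣ ℚ.+ 1ℚ
   , ℚₚ.+-mono-≤-< (ℚₚ.0≤∣p∣ (seq x N)) (ℚₚ.positive⁻¹ 1ℚ)
   , N , λ k N≤k → ℚₚ.≤-trans (∣p∣≤∣q∣+∣p-q∣ (seq x k) (seq x N))
           (ℚₚ.+-monoʳ-≤ ℚ.∣ seq x N ∣ (p k N N≤k ℕₚ.≤-refl))

_*_ : ℝ → ℝ → ℝ
x * y = mkℝ (λ k → seq x k ℚ.* seq y k) isCauchy
  where
  open ℚₚ.≤-Reasoning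
  open +-*-Solver

  K L : ℚ
  K = proj₁ (bounded x)
  L = proj₁ (bounded y)

  0<K : 0ℚ ℚ.< K
  0<K = proj₁ (proj₂ (bounded x))

  0<L : 0ℚ ℚ.< L
  0<L = proj₁ (proj₂ (bounded y))

  _/₀_ : ∀ ε {q} → 0ℚ ℚ.< q → ℚ
  _/₀_ ε {q} 0<q = (ℚ.1/ q) {{ℚ.>-nonZero 0<q}} ℚ.* (ℚ.½ ℚ.* ε)

  0</₀ : ∀ {ε q} → 0ℚ ℚ.< ε → (0<q : 0ℚ ℚ.< q) → 0ℚ ℚ.< ε /₀ 0<q
  0</₀ {q = q} 0<ε 0<q =
    0<pq (ℚₚ.positive⁻¹ ((ℚ.1/ q) {{ℚ.>-nonZero 0<q}}) {{ℚₚ.1/pos⇒pos q {{ℚ.positive 0<q}}}})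
         (0<½ε 0<ε)

  *-/₀ : ∀ ε {q} (0<q : 0ℚ ℚ.< q) → q ℚ.* (ε /₀ 0<q) ≡ ℚ.½ ℚ.* ε
  *-/₀ ε {q} 0<q = trans (sym (ℚₚ.*-assoc q _ (ℚ.½ ℚ.* ε)))
    (trans (cong (ℚ._* (ℚ.½ ℚ.* ε)) (ℚₚ.*-inverseʳ q {{ℚ.>-nonZero 0<q}}))
           (ℚₚ.*-identityˡ (ℚ.½ ℚ.* ε)))

  isCauchy : Cauchy λ k → seq x k ℚ.* seq y k
  isCauchy ε 0<ε =
    let N₁ , ∣x∣≤K = proj₂ (proj₂ (bounded x))
        N₂ , ∣y∣≤L = proj₂ (proj₂ (bounded y))
        N₃ , p     = cauchy x (ε /₀ 0<L) (0</₀ 0<ε 0<L)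
        N₄ , q     = cauchy y (ε /₀ 0<K) (0</₀ 0<ε 0<K)
        N          = (N₁ ℕ.⊔ N₂) ℕ.⊔ (N₃ ℕ.⊔ N₄)
        N₁≤ = λ {k} (N≤k : N ℕ.≤ k) →
          ℕₚ.m⊔n≤o⇒m≤o N₁ N₂ (ℕₚ.m⊔n≤o⇒m≤o (N₁ ℕ.⊔ N₂) (N₃ ℕ.⊔ N₄) N≤k)
        N₂≤ = λ {k} (N≤k : N ℕ.≤ k) →
          ℕₚ.m⊔n≤o⇒n≤o N₁ N₂ (ℕₚ.m⊔n≤o⇒m≤o (N₁ ℕ.⊔ N₂) (N₃ ℕ.⊔ N₄) N≤k)
        N₃≤ = λ {k} (N≤k : N ℕ.≤ k) →
          ℕₚ.m⊔n≤o⇒m≤o N₃ N₄ (ℕₚ.m⊔n≤o⇒n≤o (N₁ ℕ.⊔ N₂) (N₃ ℕ.⊔ N₄) N≤k)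
        N₄≤ = λ {k} (N≤k : N ℕ.≤ k) →
          ℕₚ.m⊔n≤o⇒n≤o N₃ N₄ (ℕₚ.m⊔n≤o⇒n≤o (N₁ ℕ.⊔ N₂) (N₃ ℕ.⊔ N₄) N≤k)
    in N , λ j k N≤j N≤k → begin
      ℚ.∣ seq x j ℚ.* seq y j ℚ.- seq x k ℚ.* seq y k ∣
        ≡⟨ cong ℚ.∣_∣ (solve 4 (λ a b c d → a :* b :- c :* d := a :* (b :- d) :+ d :* (a :- c))
             refl (seq x j) (seq y j) (seq x k) (seq y k)) ⟩
      ℚ.∣ seq x j ℚ.* (seq y j ℚ.- seq y k) ℚ.+ seq y k ℚ.* (seq x j ℚ.- seq x k) ∣
        ≤⟨ ℚₚ.∣p+q∣≤∣p∣+∣q∣ (seq x j ℚ.* (seq y j ℚ.- seq y k)) (seq y k ℚ.* (seq x j ℚ.- seq x k)) ⟩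
      ℚ.∣ seq x j ℚ.* (seq y j ℚ.- seq y k) ∣ ℚ.+ ℚ.∣ seq y k ℚ.* (seq x j ℚ.- seq x k) ∣
        ≡⟨ cong₂ ℚ._+_ (ℚₚ.∣p*q∣≡∣p∣*∣q∣ (seq x j) (seq y j ℚ.- seq y k))
                       (ℚₚ.∣p*q∣≡∣p∣*∣q∣ (seq y k) (seq x j ℚ.- seq x k)) ⟩
      ℚ.∣ seq x j ∣ ℚ.* ℚ.∣ seq y j ℚ.- seq y k ∣ ℚ.+ ℚ.∣ seq y k ∣ ℚ.* ℚ.∣ seq x j ℚ.- seq x k ∣
        ≤⟨ ℚₚ.+-mono-≤
             (*-mono-≤-nonNeg (ℚₚ.0≤∣p∣ (seq y j ℚ.- seq y k)) (ℚₚ.<⇒≤ 0<K)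
               (∣x∣≤K j (N₁≤ N≤j)) (q j k (N₄≤ N≤j) (N₄≤ N≤k)))
             (*-mono-≤-nonNeg (ℚₚ.0≤∣p∣ (seq x j ℚ.- seq x k)) (ℚₚ.<⇒≤ 0<L)
               (∣y∣≤L k (N₂≤ N≤k)) (p j k (N₃≤ N≤j) (N₃≤ N≤k))) ⟩
      K ℚ.* (ε /₀ 0<K) ℚ.+ L ℚ.* (ε /₀ 0<L)
        ≡⟨ cong₂ ℚ._+_ (*-/₀ ε 0<K) (*-/₀ ε 0<L) ⟩
      ℚ.½ ℚ.* ε ℚ.+ ℚ.½ ℚ.* ε
        ≡⟨ ½ε+½ε≡ε ε ⟩
      ε ∎

recip : ∀ x → x # 0ℝ → ℝ
recip x (δ , 0<δ , M , δ≤∣x∣) = mkℝ (λ k → inv (seq x k)) isCauchy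
  where
  open ℚₚ.≤-Reasoning
  open +-*-Solver

  δ≤∣x∣′ : ∀ k → M ℕ.≤ k → δ ℚ.≤ ℚ.∣ seq x k ∣
  δ≤∣x∣′ k M≤k = subst (λ t → δ ℚ.≤ ℚ.∣ t ∣) (ℚₚ.+-identityʳ (seq x k)) (δ≤∣x∣ k M≤k)

  x≢0 : ∀ k → M ℕ.≤ k → seq x k ≢ 0ℚ
  x≢0 k M≤k x≡0 = ℚₚ.<-irrefl refl (ℚₚ.<-≤-trans 0<δ (subst (λ t → δ ℚ.≤ ℚ.∣ t ∣) x≡0 (δ≤∣x∣′ k M≤k)))

  isCauchy : Cauchy λ k → inv (seq x k)
  isCauchy ε 0<ε =
    let N , p = cauchy x (δ ℚ.* δ ℚ.* ε) (0<pq (0<pq 0<δ 0<δ) 0<ε)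
    in M ℕ.⊔ N , λ j k M⊔N≤j M⊔N≤k →
    let a   = seq x j
        b   = seq x k
        d   = inv a ℚ.- inv b
        M≤j = ℕₚ.m⊔n≤o⇒m≤o M N M⊔N≤j
        M≤k = ℕₚ.m⊔n≤o⇒m≤o M N M⊔N≤k
    in ℚₚ.*-cancelˡ-≤-pos (δ ℚ.* δ) {{ℚ.positive (0<pq 0<δ 0<δ)}} (begin
      δ ℚ.* δ ℚ.* ℚ.∣ d ∣
        ≤⟨ ℚₚ.*-monoʳ-≤-nonNeg ℚ.∣ d ∣ {{ℚₚ.∣-∣-nonNeg d}}
             (*-mono-≤-nonNeg (ℚₚ.<⇒≤ 0<δ) (ℚₚ.0≤∣p∣ a) (δ≤∣x∣′ j M≤j) (δ≤∣x∣′ k M≤k)) ⟩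
      ℚ.∣ a ∣ ℚ.* ℚ.∣ b ∣ ℚ.* ℚ.∣ d ∣
        ≡⟨ cong (ℚ._* ℚ.∣ d ∣) (ℚₚ.∣p*q∣≡∣p∣*∣q∣ a b) ⟨
      ℚ.∣ a ℚ.* b ∣ ℚ.* ℚ.∣ d ∣
        ≡⟨ ℚₚ.∣p*q∣≡∣p∣*∣q∣ (a ℚ.* b) d ⟨
      ℚ.∣ a ℚ.* b ℚ.* d ∣
        ≡⟨ cong ℚ.∣_∣ (solve 4 (λ a b c d → a :* b :* (c :- d) := b :* (a :* c) :- a :* (b :* d))
             refl a b (inv a) (inv b)) ⟩
      ℚ.∣ b ℚ.* (a ℚ.* inv a) ℚ.- a ℚ.* (b ℚ.* inv b) ∣
        ≡⟨ cong₂ (λ s t → ℚ.∣ b ℚ.* s ℚ.- a ℚ.* t ∣) (*-invʳ a (x≢0 j M≤j)) (*-invʳ b (x≢0 k M≤k)) ⟩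
      ℚ.∣ b ℚ.* 1ℚ ℚ.- a ℚ.* 1ℚ ∣
        ≡⟨ cong₂ (λ s t → ℚ.∣ s ℚ.- t ∣) (ℚₚ.*-identityʳ b) (ℚₚ.*-identityʳ a) ⟩
      ℚ.∣ b ℚ.- a ∣
        ≤⟨ p k j (ℕₚ.m⊔n≤o⇒n≤o M N M⊔N≤k) (ℕₚ.m⊔n≤o⇒n≤o M N M⊔N≤j) ⟩
      δ ℚ.* δ ℚ.* ε ∎)

infixl 7 _/_⟨_⟩

_/_⟨_⟩ : ∀ x y → y # 0ℝ → ℝ
x / y ⟨ y#0 ⟩ = x * recip y y#0

+-0-rawMonoid : RawMonoid 0ℓ 0ℓ
+-0-rawMonoid = record { _≈_ = _≈_ ; _∙_ = _+_ ; ε = 0ℝ }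

open import Algebra.Definitions.RawMonoid +-0-rawMonoid public using (sum)

------------------------------------------------------------------------
-- The cube [0,1]ⁿ and differential calculus on it

‖_‖₁ : (Fin n → ℝ) → ℝ
‖ x ‖₁ = sum λ i → ∣ x i ∣

-- The constructive form of x ≠ 0⃗: some coordinate is apart from 0.
_#0⃗ : (Fin n → ℝ) → Set
x #0⃗ = ∃[ i ] x i # 0ℝ

0≤sum∣x∣ : (x : Fin n → ℝ) → ∀ k → 0ℚ ℚ.≤ seq ‖ x ‖₁ k
0≤sum∣x∣ {ℕ.zero}  x k = ℚₚ.≤-refl
0≤sum∣x∣ {ℕ.suc n} x k =
  ℚₚ.+-mono-≤ (ℚₚ.0≤∣p∣ (seq (x zero) k)) (0≤sum∣x∣ (λ i → x (suc i)) k)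

∣xᵢ∣≤sum∣x∣ : (x : Fin n → ℝ) → ∀ i k → ℚ.∣ seq (x i) k ∣ ℚ.≤ seq ‖ x ‖₁ k
∣xᵢ∣≤sum∣x∣ x zero    k = subst (ℚ._≤ seq ‖ x ‖₁ k) (ℚₚ.+-identityʳ _)
  (ℚₚ.+-monoʳ-≤ ℚ.∣ seq (x zero) k ∣ (0≤sum∣x∣ (λ i → x (suc i)) k))
∣xᵢ∣≤sum∣x∣ x (suc i) k = subst (ℚ._≤ seq ‖ x ‖₁ k) (ℚₚ.+-identityˡ _)
  (ℚₚ.+-mono-≤ (ℚₚ.0≤∣p∣ (seq (x zero) k)) (∣xᵢ∣≤sum∣x∣ (λ i → x (suc i)) i k))

#0⃗⇒‖‖₁#0 : (x : Fin n → ℝ) → x #0⃗ → ‖ x ‖₁ # 0ℝ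
#0⃗⇒‖‖₁#0 x (i , δ , 0<δ , N , δ≤∣xᵢ∣) = δ , 0<δ , N , λ k N≤k → begin
  δ                            ≤⟨ δ≤∣xᵢ∣ k N≤k ⟩
  ℚ.∣ seq (x i) k ℚ.- 0ℚ ∣     ≡⟨ cong ℚ.∣_∣ (ℚₚ.+-identityʳ (seq (x i) k)) ⟩
  ℚ.∣ seq (x i) k ∣            ≤⟨ ∣xᵢ∣≤sum∣x∣ x i k ⟩
  seq ‖ x ‖₁ k                 ≡⟨ ℚₚ.0≤p⇒∣p∣≡p (0≤sum∣x∣ x k) ⟨
  ℚ.∣ seq ‖ x ‖₁ k ∣           ≡⟨ cong ℚ.∣_∣ (ℚₚ.+-identityʳ (seq ‖ x ‖₁ k)) ⟨
  ℚ.∣ seq ‖ x ‖₁ k ℚ.- 0ℚ ∣    ∎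
  where open ℚₚ.≤-Reasoning

record Cube (n : ℕ) : Set where
  constructor mkCube
  field
    pt   : Fin n → ℝ
    0≤pt : ∀ i → 0ℝ ≤ pt i
    pt≤1 : ∀ i → pt i ≤ 1ℝ

open Cube public

Continuous : (Cube n → ℝ) → Set
Continuous {n} G = ∀ x ε → 0ℝ < ε → ∃[ δ ] 0ℝ < δ ×
  (∀ (y : Cube n) → (∀ i → ∣ pt y i - pt x i ∣ ≤ δ) → ∣ G y - G x ∣ ≤ ε)

-- d = ∂G/∂xᵢ at x, one-sided on the boundary of the cube. The point y ranges
-- over the points of the cube on the line through x in direction i.
IsPartial : (Cube n → ℝ) → Fin n → Cube n → ℝ → Set
IsPartial {n} G i x d = ∀ ε → 0ℝ < ε → ∃[ δ ] 0ℝ < δ ×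
  (∀ (y : Cube n) → (∀ k → k ≢ i → pt y k ≈ pt x k) → ∣ pt y i - pt x i ∣ ≤ δ →
   ∣ G y - G x - d * (pt y i - pt x i) ∣ ≤ ε * ∣ pt y i - pt x i ∣)

record TwiceContinuouslyDifferentiable (F : Cube n → ℝ) : Set where
  field
    ∇             : Cube n → Fin n → ℝ
    ∇²            : Cube n → Fin n → Fin n → ℝ
    ∇-partial     : ∀ x i → IsPartial F i x (∇ x i)
    ∇²-partial    : ∀ x i j → IsPartial (λ y → ∇ y i) j x (∇² x i j)
    F-continuous  : Continuous F
    ∇-continuous  : ∀ i → Continuous λ x → ∇ x i
    ∇²-continuous : ∀ i j → Continuous λ x → ∇² x i j

module _ {F : Cube n → ℝ} (F-C² : TwiceContinuouslyDifferentiable F) where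
  open TwiceContinuouslyDifferentiable F-C²

  OneSidedSmoothAt : ℝ → (x : Cube n) → pt x #0⃗ → Set
  OneSidedSmoothAt σ x x#0 = ∀ (u : Cube n) →
    ½ * (sum λ i → sum λ j → pt u i * ∇² x i j * pt u j) ≤
    σ * (‖ pt u ‖₁ / ‖ pt x ‖₁ ⟨ #0⃗⇒‖‖₁#0 (pt x) x#0 ⟩) * (sum λ i → pt u i * ∇ x i)

OneSidedSmooth : ℝ → (Cube n → ℝ) → Set
OneSidedSmooth {n} σ F =
  Σ[ F-C² ∈ TwiceContinuouslyDifferentiable F ]
    (∀ (x : Cube n) (x#0 : pt x #0⃗) → OneSidedSmoothAt F-C² σ x x#0)

------------------------------------------------------------------------
-- Set functions

infixl 6 _+ₛ_ _-ₛ_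

_+ₛ_ _-ₛ_ : Subset n → Fin n → Subset n
S +ₛ i = S ∪ ⁅ i ⁆
S -ₛ i = S Subset.- i

B : (Subset n → ℝ) → Fin n → Subset n → ℝ
B f i S = f (S +ₛ i) - f (S -ₛ i)

A : (Subset n → ℝ) → Fin n → Fin n → Subset n → ℝ
A f i j S = B f j (S +ₛ i) - B f j (S -ₛ i)

fromℕ#0 : ∀ {k} → 0 ℕ.< k → fromℕ k # 0ℝ
fromℕ#0 {k@(ℕ.suc _)} _ =
  + k ℚ./ 1 , ℚₚ.positive⁻¹ _ {{ℚₚ.normalize-pos k 1}} , 0 , λ _ _ →
  ℚₚ.≤-reflexive (sym (trans
    (cong ℚ.∣_∣ (ℚₚ.+-identityʳ (+ k ℚ./ 1)))
    (ℚₚ.0≤p⇒∣p∣≡p (ℚₚ.<⇒≤ (ℚₚ.positive⁻¹ _ {{ℚₚ.normalize-pos k 1}})))))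

nonempty⇒∣∣#0 : {S : Subset n} → Nonempty S → fromℕ Subset.∣ S ∣ # 0ℝ
nonempty⇒∣∣#0 (_ , i∈S) = fromℕ#0 (ℕₚ.≤-<-trans ℕ.z≤n (x∈p⇒∣p-x∣<∣p∣ i∈S))

MetaSubmodular : ℝ → (Subset n → ℝ) → Set
MetaSubmodular {n} γ f = ∀ (S : Subset n) (S≢∅ : Nonempty S) (i j : Fin n) →
  A f i j S ≤ γ * ((B f i S + B f j S) / fromℕ Subset.∣ S ∣ ⟨ nonempty⇒∣∣#0 S≢∅ ⟩)

sumSubsets : (Subset n → ℝ) → ℝ
sumSubsets {ℕ.zero}  g = g []
sumSubsets {ℕ.suc n} g =
  sumSubsets (λ R → g (inside ∷ R)) + sumSubsets (λ R → g (outside ∷ R))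

-- prodOver R g is the product of g v over the elements v of R.
prodOver : Subset n → (Fin n → ℝ) → ℝ
prodOver []            g = 1ℝ
prodOver (inside  ∷ R) g = g zero * prodOver R (λ v → g (suc v))
prodOver (outside ∷ R) g = prodOver R (λ v → g (suc v))

multilinear : (Subset n → ℝ) → Cube n → ℝ
multilinear f x = sumSubsets λ R →
  f R * prodOver R (pt x) * prodOver (∁ R) (λ v → 1ℝ - pt x v)

-- At the vertex 1_S the gradient of F is (B_i(S))ᵢ and the Hessian is (A_ij(S))ᵢⱼ,
-- because F is affine in each coordinate with slope the multilinear extension of the
-- difference of f in that coordinate. Smoothness at 1_S in the direction
-- u = ½(e_i + e_j), with ‖u‖₁ = 1 and ‖1_S‖₁ = |S|, is then the asserted inequality
-- multiplied by ¼. Unlike e_i + e_j, this u stays in the cube for i = j, so no case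
-- distinction is needed. Differentiability is only used along segments between rational
-- points, where F is computed termwise on the Cauchy sequences of the values of f.

module Submission where

open import Defs
open import Algebra.Bundles using (CommutativeRing)
open import Data.Bool.Base using (if_then_else_; true; false)
open import Data.Bool.Properties using (∨-zeroʳ; ∨-identityʳ)
open import Data.Fin.Base using (Fin; zero; suc)
import Data.Fin.Properties as Finₚ
open import Data.Fin.Subset as Subset using (Subset; inside; outside; ∁; Nonempty)
open import Data.Fin.Subset.Properties using (∪-identityʳ; p─⊥≡p)
open import Data.Integer.Base as ℤ using (+_)
import Data.Integer.Properties as ℤₚ
open import Data.Nat.Base as ℕ using (ℕ)
import Data.Nat.Coprimality as Coprimality
import Data.Nat.Properties as ℕₚ
open import Data.Product.Base using (∃-syntax; _×_; _,_; proj₁; proj₂)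
open import Data.Rational.Base as ℚ using (ℚ; 0ℚ; 1ℚ)
import Data.Rational.Properties as ℚₚ
open import Data.Rational.Solver using (module +-*-Solver)
open import Data.Sum.Base using (inj₁; inj₂)
open import Data.Vec.Base using ([]; _∷_; lookup; _[_]≔_)
open import Data.Vec.Functional using (updateAt)
open import Data.Vec.Functional.Properties using (updateAt-updates; updateAt-minimal)
open import Data.Vec.Properties using ([]≔-idempotent; []≔-commutes; []=⇒lookup)
open import Function.Base using (_∘_; const)
open import Relation.Binary.PropositionalEquality
  using (_≡_; _≢_; refl; sym; trans; cong; cong₂; subst; module ≡-Reasoning)
open import Relation.Nullary using (yes; no)

open import Algebra.Properties.Semiring.Sum (CommutativeRing.semiring ℚₚ.+-*-commutativeRing)
  using (sum-cong-≗; ∑-distrib-+; *-distribˡ-sum; sum-replicate-zero)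
  renaming (sum to ∑)

private
  variable
    n : ℕ

-- Multilinear extension of rational set functions

-- Splitting on the first coordinate, instead of summing over all subsets, makes affineness in each
-- coordinate an induction on `n`.
ext : (Subset n → ℚ) → (Fin n → ℚ) → ℚ
ext {ℕ.zero}  f x = f []
ext {ℕ.suc n} f x = x zero ℚ.* ext (f ∘ (inside ∷_)) (x ∘ suc) ℚ.+
                    (1ℚ ℚ.- x zero) ℚ.* ext (f ∘ (outside ∷_)) (x ∘ suc)

ext-cong : {f g : Subset n → ℚ} {x y : Fin n → ℚ} →
           (∀ R → f R ≡ g R) → (∀ a → x a ≡ y a) → ext f x ≡ ext g y
ext-cong {ℕ.zero}  f≗g x≗y = f≗g []
ext-cong {ℕ.suc n} f≗g x≗y = cong₂ ℚ._+_
  (cong₂ ℚ._*_ (x≗y zero) (ext-cong (f≗g ∘ (inside ∷_)) (x≗y ∘ suc)))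
  (cong₂ ℚ._*_ (cong (ℚ._-_ 1ℚ) (x≗y zero)) (ext-cong (f≗g ∘ (outside ∷_)) (x≗y ∘ suc)))

ext-minus : (f g : Subset n → ℚ) (x : Fin n → ℚ) →
            ext (λ R → f R ℚ.- g R) x ≡ ext f x ℚ.- ext g x
ext-minus {ℕ.zero}  f g x = refl
ext-minus {ℕ.suc n} f g x = trans
  (cong₂ (λ s t → x zero ℚ.* s ℚ.+ (1ℚ ℚ.- x zero) ℚ.* t)
    (ext-minus (f ∘ (inside ∷_)) (g ∘ (inside ∷_)) (x ∘ suc))
    (ext-minus (f ∘ (outside ∷_)) (g ∘ (outside ∷_)) (x ∘ suc)))
  (solve 5 (λ x p q r s → x :* (p :- q) :+ (con 1ℚ :- x) :* (r :- s) :=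
                          x :* p :+ (con 1ℚ :- x) :* r :- (x :* q :+ (con 1ℚ :- x) :* s))
    refl (x zero) _ _ _ _)
  where open +-*-Solver

-- The discrete derivative in direction `i`. Updating the vector at `i` reduces together with the
-- recursion of `ext`, which union with a singleton does not.
Δ : Fin n → (Subset n → ℚ) → Subset n → ℚ
Δ i φ S = φ (S [ i ]≔ inside) ℚ.- φ (S [ i ]≔ outside)

-- The increment along an axis is exactly linear, with no error term. In the base case `Δ zero φ`
-- restricts to the same function on both halves, so the weights `x zero` and `1 - x zero` add up to
-- one there.
ext-affine : (φ : Subset n → ℚ) (i : Fin n) {x y : Fin n → ℚ} →
             (∀ a → a ≢ i → y a ≡ x a) →
             ext φ y ℚ.- ext φ x ≡ (y i ℚ.- x i) ℚ.* ext (Δ i φ) x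
ext-affine φ zero {x} {y} y≗x
  rewrite ext-cong {f = φ ∘ (inside ∷_)} (λ _ → refl) (λ a → y≗x (suc a) λ ())
        | ext-cong {f = φ ∘ (outside ∷_)} (λ _ → refl) (λ a → y≗x (suc a) λ ())
        | ext-minus (φ ∘ (inside ∷_)) (φ ∘ (outside ∷_)) (x ∘ suc)
  = solve 4 (λ x y p q →
      y :* p :+ (con 1ℚ :- y) :* q :- (x :* p :+ (con 1ℚ :- x) :* q) :=
      (y :- x) :* (x :* (p :- q) :+ (con 1ℚ :- x) :* (p :- q)))
      refl (x zero) (y zero)
      (ext (φ ∘ (inside ∷_)) (x ∘ suc)) (ext (φ ∘ (outside ∷_)) (x ∘ suc))
  where open +-*-Solver
ext-affine φ (suc i) {x} {y} y≗x rewrite y≗x zero (λ ()) = trans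
  (solve 5 (λ x p q r s → x :* p :+ (con 1ℚ :- x) :* q :- (x :* r :+ (con 1ℚ :- x) :* s) :=
                          x :* (p :- r) :+ (con 1ℚ :- x) :* (q :- s))
    refl (x zero) _ _ _ _)
  (trans
    (cong₂ (λ s t → x zero ℚ.* s ℚ.+ (1ℚ ℚ.- x zero) ℚ.* t)
      (ext-affine (φ ∘ (inside ∷_)) i λ a a≢i → y≗x (suc a) λ { refl → a≢i refl })
      (ext-affine (φ ∘ (outside ∷_)) i λ a a≢i → y≗x (suc a) λ { refl → a≢i refl }))
    (solve 4 (λ x h p q → x :* (h :* p) :+ (con 1ℚ :- x) :* (h :* q) :=
                          h :* (x :* p :+ (con 1ℚ :- x) :* q))
      refl (x zero) (y (suc i) ℚ.- x (suc i)) _ _))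
  where open +-*-Solver

χ : Subset n → Fin n → ℚ
χ S a = if lookup S a then 1ℚ else 0ℚ

ext-χ : (f : Subset n → ℚ) (S : Subset n) → ext f (χ S) ≡ f S
ext-χ f []            = refl
ext-χ f (inside  ∷ S) = trans
  (solve 2 (λ p q → con 1ℚ :* p :+ (con 1ℚ :- con 1ℚ) :* q := p) refl _
    (ext (f ∘ (outside ∷_)) (χ S)))
  (ext-χ (f ∘ (inside ∷_)) S)
  where open +-*-Solver
ext-χ f (outside ∷ S) = trans
  (solve 2 (λ p q → con 0ℚ :* p :+ (con 1ℚ :- con 0ℚ) :* q := q) refl
    (ext (f ∘ (inside ∷_)) (χ S)) _)
  (ext-χ (f ∘ (outside ∷_)) S)
  where open +-*-Solver

-- The scalar c collects the factors split off from the products during the induction.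
seq-sumSubsets : ∀ k c (g : Subset n → ℝ) (f : Subset n → ℚ) (x : Fin n → ℝ) →
  (∀ R → seq (g R) k ≡
         c ℚ.* (f R ℚ.* seq (prodOver R x) k ℚ.* seq (prodOver (∁ R) (λ v → 1ℝ - x v)) k)) →
  seq (sumSubsets g) k ≡ c ℚ.* ext f (λ a → seq (x a) k)
seq-sumSubsets {ℕ.zero}  k c g f x g≗ = trans (g≗ [])
  (solve 2 (λ c f → c :* (f :* con 1ℚ :* con 1ℚ) := c :* f) refl c (f []))
  where open +-*-Solver
seq-sumSubsets {ℕ.suc n} k c g f x g≗ = trans
  (cong₂ ℚ._+_
    (seq-sumSubsets k (c ℚ.* x₀) (g ∘ (inside ∷_)) (f ∘ (inside ∷_)) (x ∘ suc) λ R →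
      trans (g≗ (inside ∷ R))
        (solve 5 (λ c x f p q → c :* (f :* (x :* p) :* q) := c :* x :* (f :* p :* q))
          refl c x₀ (f (inside ∷ R)) (seq (prodOver R (x ∘ suc)) k)
          (seq (prodOver (∁ R) (λ v → 1ℝ - x (suc v))) k)))
    (seq-sumSubsets k (c ℚ.* (1ℚ ℚ.- x₀)) (g ∘ (outside ∷_)) (f ∘ (outside ∷_)) (x ∘ suc) λ R →
      trans (g≗ (outside ∷ R))
        (solve 5 (λ c x f p q → c :* (f :* p :* ((con 1ℚ :- x) :* q)) :=
                                c :* (con 1ℚ :- x) :* (f :* p :* q))
          refl c x₀ (f (outside ∷ R)) (seq (prodOver R (x ∘ suc)) k)
          (seq (prodOver (∁ R) (λ v → 1ℝ - x (suc v))) k))))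
  (solve 4 (λ c x p q → c :* x :* p :+ c :* (con 1ℚ :- x) :* q :=
                        c :* (x :* p :+ (con 1ℚ :- x) :* q))
    refl c x₀ _ _)
  where
  open +-*-Solver
  x₀ = seq (x zero) k

-- Sums and products of reals act termwise on the representing sequences, so the two sides agree at
-- every index `k` and not merely in the limit.
seq-multilinear : ∀ k (f : Subset n → ℝ) (x : Cube n) →
  seq (multilinear f x) k ≡ ext (λ R → seq (f R) k) (λ a → seq (pt x a) k)
seq-multilinear k f x = trans
  (seq-sumSubsets k 1ℚ _ (λ R → seq (f R) k) (pt x) λ R → sym (ℚₚ.*-identityˡ _))
  (ℚₚ.*-identityˡ _)

-- Asymptotic equality of rational sequences

infix 4 _≃_

-- At u = seq x and v = seq y the field is x ≈ y; a record, since u and v cannot be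
-- inferred from the unfolded statement.
record _≃_ (u v : ℕ → ℚ) : Set where
  constructor ⟪_⟫
  field
    close : ∀ ε → 0ℚ ℚ.< ε → Eventually λ k → ℚ.∣ u k ℚ.- v k ∣ ℚ.≤ ε

open _≃_

eventually₂ : {P Q R : ℕ → Set} → (∀ k → P k → Q k → R k) →
              Eventually P → Eventually Q → Eventually R
eventually₂ imp (M , p) (N , q) = M ℕ.⊔ N , λ k M⊔N≤k →
  imp k (p k (ℕₚ.m⊔n≤o⇒m≤o M N M⊔N≤k)) (q k (ℕₚ.m⊔n≤o⇒n≤o M N M⊔N≤k))

always : {P : ℕ → Set} → (∀ k → P k) → Eventually P
always p = 0 , λ k _ → p k

∣p-r∣≤ : ∀ p q r {ε δ} → ℚ.∣ p ℚ.- q ∣ ℚ.≤ ε → ℚ.∣ q ℚ.- r ∣ ℚ.≤ δ → ℚ.∣ p ℚ.- r ∣ ℚ.≤ ε ℚ.+ δ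
∣p-r∣≤ p q r {ε} {δ} p-q q-r = begin
  ℚ.∣ p ℚ.- r ∣
    ≡⟨ cong ℚ.∣_∣ (solve 3 (λ p q r → p :- r := (p :- q) :+ (q :- r)) refl p q r) ⟩
  ℚ.∣ (p ℚ.- q) ℚ.+ (q ℚ.- r) ∣
    ≤⟨ ℚₚ.∣p+q∣≤∣p∣+∣q∣ (p ℚ.- q) (q ℚ.- r) ⟩
  ℚ.∣ p ℚ.- q ∣ ℚ.+ ℚ.∣ q ℚ.- r ∣
    ≤⟨ ℚₚ.+-mono-≤ p-q q-r ⟩
  ε ℚ.+ δ ∎
  where
  open ℚₚ.≤-Reasoning
  open +-*-Solver

p≤q+∣p-q∣ : ∀ p q → p ℚ.≤ q ℚ.+ ℚ.∣ p ℚ.- q ∣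
p≤q+∣p-q∣ p q = begin
  p                        ≡⟨ solve 2 (λ p q → p := q :+ (p :- q)) refl p q ⟩
  q ℚ.+ (p ℚ.- q)          ≤⟨ ℚₚ.+-monoʳ-≤ q (p≤∣p∣ (p ℚ.- q)) ⟩
  q ℚ.+ ℚ.∣ p ℚ.- q ∣      ∎
  where
  open ℚₚ.≤-Reasoning
  open +-*-Solver
  p≤∣p∣ : ∀ p → p ℚ.≤ ℚ.∣ p ∣
  p≤∣p∣ p with ℚₚ.≤-total 0ℚ p
  ... | inj₁ 0≤p = ℚₚ.≤-reflexive (sym (ℚₚ.0≤p⇒∣p∣≡p 0≤p))
  ... | inj₂ p≤0 = ℚₚ.≤-trans p≤0 (ℚₚ.0≤∣p∣ p)

≗⇒≃ : ∀ {u v} → (∀ k → u k ≡ v k) → u ≃ v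
≗⇒≃ {u} {v} u≗v = ⟪ (λ ε 0<ε → always λ k → ℚₚ.≤-trans
  (ℚₚ.≤-reflexive (cong ℚ.∣_∣ (trans (cong (ℚ._- v k) (u≗v k)) (ℚₚ.+-inverseʳ (v k)))))
  (ℚₚ.<⇒≤ 0<ε)) ⟫

≃-sym : ∀ {u v} → u ≃ v → v ≃ u
≃-sym {u} {v} u≃v = ⟪ (λ ε 0<ε → let N , p = close u≃v ε 0<ε in
  N , λ k N≤k → subst (ℚ._≤ ε) (∣p-q∣≡∣q-p∣ (u k) (v k)) (p k N≤k)) ⟫

≃-trans : ∀ {u v w} → u ≃ v → v ≃ w → u ≃ w
≃-trans {u} {v} {w} u≃v v≃w = ⟪ (λ ε 0<ε → eventually₂
  (λ k p q → subst (ℚ.∣ u k ℚ.- w k ∣ ℚ.≤_) (½ε+½ε≡ε ε) (∣p-r∣≤ (u k) (v k) (w k) p q))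
  (close u≃v _ (0<½ε 0<ε)) (close v≃w _ (0<½ε 0<ε))) ⟫

+-cong-≃ : ∀ {u u′ v v′} → u ≃ u′ → v ≃ v′ → (λ k → u k ℚ.+ v k) ≃ (λ k → u′ k ℚ.+ v′ k)
+-cong-≃ {u} {u′} {v} {v′} u≃u′ v≃v′ = ⟪ (λ ε 0<ε → eventually₂
  (λ k p q → begin
    ℚ.∣ (u k ℚ.+ v k) ℚ.- (u′ k ℚ.+ v′ k) ∣
      ≡⟨ cong ℚ.∣_∣ (solve 4 (λ a b c d → (a :+ b) :- (c :+ d) := (a :- c) :+ (b :- d))
           refl (u k) (v k) (u′ k) (v′ k)) ⟩
    ℚ.∣ (u k ℚ.- u′ k) ℚ.+ (v k ℚ.- v′ k) ∣
      ≤⟨ ℚₚ.∣p+q∣≤∣p∣+∣q∣ (u k ℚ.- u′ k) (v k ℚ.- v′ k) ⟩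
    ℚ.∣ u k ℚ.- u′ k ∣ ℚ.+ ℚ.∣ v k ℚ.- v′ k ∣
      ≤⟨ ℚₚ.+-mono-≤ p q ⟩
    ℚ.½ ℚ.* ε ℚ.+ ℚ.½ ℚ.* ε
      ≡⟨ ½ε+½ε≡ε ε ⟩
    ε ∎)
  (close u≃u′ _ (0<½ε 0<ε)) (close v≃v′ _ (0<½ε 0<ε))) ⟫
  where
  open ℚₚ.≤-Reasoning
  open +-*-Solver

minus-cong-≃ : ∀ {u u′ v v′} → u ≃ u′ → v ≃ v′ → (λ k → u k ℚ.- v k) ≃ (λ k → u′ k ℚ.- v′ k)
minus-cong-≃ {u} {u′} {v} {v′} u≃u′ v≃v′ =
  +-cong-≃ {u} {u′} {λ k → ℚ.- v k} {λ k → ℚ.- v′ k} u≃u′ ⟪ (λ ε 0<ε →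
    let N , p = close v≃v′ ε 0<ε in
    N , λ k N≤k → subst (ℚ._≤ ε)
      (trans (∣p-q∣≡∣q-p∣ (v k) (v′ k))
        (cong ℚ.∣_∣ (solve 2 (λ a b → b :- a := (:- a) :- (:- b)) refl (v k) (v′ k))))
      (p k N≤k)) ⟫
  where open +-*-Solver

-- The left factor is a real because the estimate needs a bound `K` for it, which the Cauchy
-- property supplies. The error is scaled down by `K` in advance.
*-congˡ-≃ : ∀ (x : ℝ) {u v} → u ≃ v → (λ k → seq x k ℚ.* u k) ≃ (λ k → seq x k ℚ.* v k)
*-congˡ-≃ x {u} {v} u≃v = ⟪ (λ ε 0<ε → let δ = inv K ℚ.* ε in eventually₂
  (λ k ∣x∣≤K p → begin
    ℚ.∣ seq x k ℚ.* u k ℚ.- seq x k ℚ.* v k ∣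
      ≡⟨ cong ℚ.∣_∣ (solve 3 (λ x u v → x :* u :- x :* v := x :* (u :- v)) refl (seq x k) (u k) (v k)) ⟩
    ℚ.∣ seq x k ℚ.* (u k ℚ.- v k) ∣
      ≡⟨ ℚₚ.∣p*q∣≡∣p∣*∣q∣ (seq x k) (u k ℚ.- v k) ⟩
    ℚ.∣ seq x k ∣ ℚ.* ℚ.∣ u k ℚ.- v k ∣
      ≤⟨ *-mono-≤-nonNeg (ℚₚ.0≤∣p∣ (u k ℚ.- v k)) (ℚₚ.<⇒≤ 0<K) ∣x∣≤K p ⟩
    K ℚ.* (inv K ℚ.* ε)
      ≡⟨ ℚₚ.*-assoc K (inv K) ε ⟨
    K ℚ.* inv K ℚ.* ε
      ≡⟨ cong (ℚ._* ε) (*-invʳ K K≢0) ⟩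
    1ℚ ℚ.* ε
      ≡⟨ ℚₚ.*-identityˡ ε ⟩
    ε ∎)
  (proj₂ (proj₂ (bounded x))) (close u≃v δ (0<pq 0<inv 0<ε))) ⟫
  where
  open ℚₚ.≤-Reasoning
  open +-*-Solver
  K = proj₁ (bounded x)
  0<K = proj₁ (proj₂ (bounded x))
  K≢0 : K ≢ 0ℚ
  K≢0 K≡0 = ℚₚ.<-irrefl (sym K≡0) 0<K
  0<inv : 0ℚ ℚ.< inv K
  0<inv = ℚₚ.*-cancelˡ-<-nonNeg K {{ℚ.nonNegative (ℚₚ.<⇒≤ 0<K)}}
    (subst (ℚ._< K ℚ.* inv K) (sym (ℚₚ.*-zeroʳ K))
      (subst (0ℚ ℚ.<_) (sym (*-invʳ K K≢0)) (ℚₚ.positive⁻¹ 1ℚ)))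

≤-resp-≃ : ∀ {x x′ y y′ : ℝ} → seq x ≃ seq x′ → seq y ≃ seq y′ → x ≤ y → x′ ≤ y′
≤-resp-≃ {x} {x′} {y} {y′} x≃x′ y≃y′ x≤y ε 0<ε = eventually₂
  (λ k (p , q) r → begin
    seq x′ k
      ≤⟨ p≤q+∣p-q∣ (seq x′ k) (seq x k) ⟩
    seq x k ℚ.+ ℚ.∣ seq x′ k ℚ.- seq x k ∣
      ≤⟨ ℚₚ.+-mono-≤ r p ⟩
    seq y k ℚ.+ ℚ.½ ℚ.* δ ℚ.+ ℚ.½ ℚ.* δ
      ≤⟨ ℚₚ.+-monoˡ-≤ (ℚ.½ ℚ.* δ) (ℚₚ.+-monoˡ-≤ (ℚ.½ ℚ.* δ)
           (ℚₚ.≤-trans (p≤q+∣p-q∣ (seq y k) (seq y′ k)) (ℚₚ.+-monoʳ-≤ (seq y′ k) q))) ⟩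
    seq y′ k ℚ.+ δ ℚ.+ ℚ.½ ℚ.* δ ℚ.+ ℚ.½ ℚ.* δ
      ≡⟨ solve 2 (λ y ε → y :+ con ℚ.½ :* ε :+ con ℚ.½ :* (con ℚ.½ :* ε) :+ con ℚ.½ :* (con ℚ.½ :* ε) :=
                          y :+ ε) refl (seq y′ k) ε ⟩
    seq y′ k ℚ.+ ε ∎)
  -- The error `ε` is split into a quarter for replacing `x`, a half for replacing `y` and a quarter
  -- for the given inequality.
  (eventually₂ (λ _ → _,_) (close (≃-sym x≃x′) _ (0<½ε 0<δ)) (close y≃y′ δ 0<δ))
  (x≤y _ (0<½ε 0<δ))
  where
  open ℚₚ.≤-Reasoning
  open +-*-Solver
  δ = ℚ.½ ℚ.* ε
  0<δ = 0<½ε 0<ε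

fromℚ-mono-< : ∀ {p q} → p ℚ.< q → fromℚ p < fromℚ q
fromℚ-mono-< {p} {q} p<q =
  q ℚ.- p
  , subst (ℚ._< q ℚ.- p) (ℚₚ.+-inverseʳ p) (ℚₚ.+-monoˡ-< (ℚ.- p) p<q)
  , always λ _ → ℚₚ.≤-reflexive (solve 2 (λ p q → p :+ (q :- p) := q) refl p q)
  where open +-*-Solver

fromℚ-mono-≤ : ∀ {p q} → p ℚ.≤ q → fromℚ p ≤ fromℚ q
fromℚ-mono-≤ {p} {q} p≤q ε 0<ε = always λ _ →
  ℚₚ.≤-trans p≤q (ℚₚ.≤-trans (ℚₚ.≤-reflexive (sym (ℚₚ.+-identityʳ q))) (ℚₚ.+-monoʳ-≤ q (ℚₚ.<⇒≤ 0<ε)))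

-- Rational points of the cube and uniqueness of partial derivatives

-- At a rational point the coordinates are constant sequences, so all terms of a value of the
-- multilinear extension are values of `ext` at one and the same point. Vertices, the direction `u`
-- and the increments used below are all rational.
record ℚCube (n : ℕ) : Set where
  constructor mkℚCube
  field
    coord   : Fin n → ℚ
    0≤coord : ∀ i → 0ℚ ℚ.≤ coord i
    coord≤1 : ∀ i → coord i ℚ.≤ 1ℚ

open ℚCube

-- Opaque because unification at terms that contain ⌜ x ⌝ blows up when it unfolds.
opaque
  ⌜_⌝ : ℚCube n → Cube n
  ⌜ x ⌝ = mkCube (fromℚ ∘ coord x) (fromℚ-mono-≤ ∘ 0≤coord x) (fromℚ-mono-≤ ∘ coord≤1 x)

  pt-⌜⌝ : (x : ℚCube n) (a : Fin n) → pt ⌜ x ⌝ a ≡ fromℚ (coord x a)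
  pt-⌜⌝ x a = refl

0<p⊓q : ∀ {p q} → 0ℚ ℚ.< p → 0ℚ ℚ.< q → 0ℚ ℚ.< p ℚ.⊓ q
0<p⊓q {p} {q} 0<p 0<q with ℚₚ.⊓-sel p q
... | inj₁ ≡p = subst (0ℚ ℚ.<_) (sym ≡p) 0<p
... | inj₂ ≡q = subst (0ℚ ℚ.<_) (sym ≡q) 0<q

-- A step of length `η ⊓ ½`, upward from the lower half and downward from the upper half, stays in
-- the interval because `½ + ½` computes to 1. It gives a nonzero increment even at the boundary,
-- where the derivative is one-sided.
nudge : ∀ {p η} → 0ℚ ℚ.≤ p → p ℚ.≤ 1ℚ → 0ℚ ℚ.< η →
        ∃[ q ] 0ℚ ℚ.≤ q × q ℚ.≤ 1ℚ × 0ℚ ℚ.< ℚ.∣ q ℚ.- p ∣ × ℚ.∣ q ℚ.- p ∣ ℚ.≤ η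
nudge {p} {η} 0≤p p≤1 0<η with ℚₚ.≤-total p ℚ.½
... | inj₁ p≤½ = p ℚ.+ h
  , ℚₚ.+-mono-≤ 0≤p (ℚₚ.<⇒≤ 0<h)
  , ℚₚ.+-mono-≤ p≤½ (ℚₚ.p⊓q≤q η ℚ.½)
  , subst (0ℚ ℚ.<_) (sym ∣q-p∣≡h) 0<h
  , subst (ℚ._≤ η) (sym ∣q-p∣≡h) (ℚₚ.p⊓q≤p η ℚ.½)
  where
  h = η ℚ.⊓ ℚ.½
  0<h : 0ℚ ℚ.< h
  0<h = 0<p⊓q 0<η (ℚₚ.positive⁻¹ ℚ.½)
  open +-*-Solver
  ∣q-p∣≡h : ℚ.∣ p ℚ.+ h ℚ.- p ∣ ≡ h
  ∣q-p∣≡h = trans (cong ℚ.∣_∣ (solve 2 (λ p h → p :+ h :- p := h) refl p h))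
                  (ℚₚ.0≤p⇒∣p∣≡p (ℚₚ.<⇒≤ 0<h))
... | inj₂ ½≤p = p ℚ.- h
  , ℚₚ.+-mono-≤ ½≤p (ℚₚ.neg-antimono-≤ (ℚₚ.p⊓q≤q η ℚ.½))
  , ℚₚ.+-mono-≤ p≤1 (ℚₚ.neg-antimono-≤ (ℚₚ.<⇒≤ 0<h))
  , subst (0ℚ ℚ.<_) (sym ∣q-p∣≡h) 0<h
  , subst (ℚ._≤ η) (sym ∣q-p∣≡h) (ℚₚ.p⊓q≤p η ℚ.½)
  where
  h = η ℚ.⊓ ℚ.½
  0<h : 0ℚ ℚ.< h
  0<h = 0<p⊓q 0<η (ℚₚ.positive⁻¹ ℚ.½)
  open +-*-Solver
  ∣q-p∣≡h : ℚ.∣ p ℚ.- h ℚ.- p ∣ ≡ h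
  ∣q-p∣≡h = trans (cong ℚ.∣_∣ (solve 2 (λ p h → p :- h :- p := :- h) refl p h))
                  (trans (ℚₚ.∣-p∣≡∣p∣ h) (ℚₚ.0≤p⇒∣p∣≡p (ℚₚ.<⇒≤ 0<h)))

moveCoord : (x : ℚCube n) (i : Fin n) {q : ℚ} → 0ℚ ℚ.≤ q → q ℚ.≤ 1ℚ → ℚCube n
moveCoord x i {q} 0≤q q≤1 = mkℚCube (updateAt (coord x) i (const q))
  (λ a → along (0ℚ ℚ.≤_) a 0≤q (0≤coord x a))
  (λ a → along (ℚ._≤ 1ℚ) a q≤1 (coord≤1 x a))
  where
  along : (P : ℚ → Set) → ∀ a → P q → P (coord x a) → P (updateAt (coord x) i (const q) a)
  along P a Pq Px with a Finₚ.≟ i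
  ... | yes refl = subst P (sym (updateAt-updates a (coord x))) Pq
  ... | no  a≢i  = subst P (sym (updateAt-minimal a i (coord x) a≢i)) Px

-- Rational points on the line already determine a partial derivative.
opaque
  unfolding ⌜_⌝

  partial-unique : (G : Cube n → ℝ) (i : Fin n) (x : ℚCube n) (d : ℝ) (d′ : ℕ → ℚ) →
    IsPartial G i ⌜ x ⌝ d →
    (∀ y → (∀ a → a ≢ i → coord y a ≡ coord x a) →
      (λ k → seq (G ⌜ y ⌝) k ℚ.- seq (G ⌜ x ⌝) k) ≃ λ k → (coord y i ℚ.- coord x i) ℚ.* d′ k) →
    seq d ≃ d′
  partial-unique G i x d d′ d-partial affine = ⟪ (λ ε 0<ε →
    -- Positivity of the real radius `δ` carries a rational `η` that is eventually below it, so a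
    -- rational step of length at most `η` is admissible.
    let δ , (η , 0<η , η≤δ) , d-close = d-partial (fromℚ (ℚ.½ ℚ.* ε)) (fromℚ-mono-< (0<½ε 0<ε))
        q , 0≤q , q≤1 , 0<∣q-p∣ , ∣q-p∣≤η = nudge (0≤coord x i) (coord≤1 x i) 0<η
        y   = moveCoord x i 0≤q q≤1
        y≗x = λ a a≢i → updateAt-minimal a i (coord x) a≢i
        s   = coord y i ℚ.- coord x i
        s≡  = cong (λ t → ℚ.∣ t ℚ.- coord x i ∣) (updateAt-updates i {const q} (coord x))
        0<∣s∣ = subst (0ℚ ℚ.<_) (sym s≡) 0<∣q-p∣
        ∣s∣≤η = subst (ℚ._≤ η) (sym s≡) ∣q-p∣≤η
        -- Half of the bound `∣s∣ * ε` comes from differentiability. The other half is split evenly: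
        -- `d-close` is an inequality of reals, which holds termwise only up to an error, and
        -- `affine` holds only up to `≃`.
        ϑ   = ℚ.½ ℚ.* (ℚ.½ ℚ.* ε ℚ.* ℚ.∣ s ∣)
        0<ϑ = 0<½ε (0<pq (0<½ε 0<ε) 0<∣s∣)
    in eventually₂
      (λ k p q → ℚₚ.*-cancelˡ-≤-pos ℚ.∣ s ∣ {{ℚ.positive 0<∣s∣}} (begin
        ℚ.∣ s ∣ ℚ.* ℚ.∣ seq d k ℚ.- d′ k ∣
          ≡⟨ ℚₚ.∣p*q∣≡∣p∣*∣q∣ s (seq d k ℚ.- d′ k) ⟨
        ℚ.∣ s ℚ.* (seq d k ℚ.- d′ k) ∣
          ≡⟨ cong ℚ.∣_∣ (solve 3 (λ s d d′ → s :* (d :- d′) := d :* s :- s :* d′)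
               refl s (seq d k) (d′ k)) ⟩
        ℚ.∣ seq d k ℚ.* s ℚ.- s ℚ.* d′ k ∣
          ≤⟨ ∣p-r∣≤ (seq d k ℚ.* s) (seq (G ⌜ y ⌝) k ℚ.- seq (G ⌜ x ⌝) k) (s ℚ.* d′ k)
               (subst (ℚ._≤ ℚ.½ ℚ.* ε ℚ.* ℚ.∣ s ∣ ℚ.+ ϑ) (∣p-q∣≡∣q-p∣ _ (seq d k ℚ.* s)) p) q ⟩
        ℚ.½ ℚ.* ε ℚ.* ℚ.∣ s ∣ ℚ.+ ϑ ℚ.+ ϑ
          ≡⟨ solve 2 (λ ε s → con ℚ.½ :* ε :* s :+ con ℚ.½ :* (con ℚ.½ :* ε :* s)
                                :+ con ℚ.½ :* (con ℚ.½ :* ε :* s) := s :* ε) refl ε ℚ.∣ s ∣ ⟩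
        ℚ.∣ s ∣ ℚ.* ε ∎))
      (d-close ⌜ y ⌝ (λ a a≢i → close (≗⇒≃ λ _ → y≗x a a≢i))
        (λ ε₁ 0<ε₁ → proj₁ η≤δ , λ k N≤k → begin
          ℚ.∣ s ∣         ≤⟨ ∣s∣≤η ⟩
          η               ≡⟨ ℚₚ.+-identityˡ η ⟨
          0ℚ ℚ.+ η        ≤⟨ proj₂ η≤δ k N≤k ⟩
          seq δ k         ≡⟨ ℚₚ.+-identityʳ (seq δ k) ⟨
          seq δ k ℚ.+ 0ℚ  ≤⟨ ℚₚ.+-monoʳ-≤ (seq δ k) (ℚₚ.<⇒≤ 0<ε₁) ⟩
          seq δ k ℚ.+ ε₁  ∎)
        ϑ 0<ϑ)
      (close (affine y y≗x) ϑ 0<ϑ)) ⟫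
    where
    open ℚₚ.≤-Reasoning
    open +-*-Solver

-- Gradient and Hessian of the multilinear extension

minus-≡ : ∀ {a b c d e : ℚ} → a ≡ c → b ≡ d → c ℚ.- d ≡ e → a ℚ.- b ≡ e
minus-≡ refl refl c-d≡e = c-d≡e

seq-multilinear-⌜⌝ : ∀ k (f : Subset n → ℝ) (x : ℚCube n) →
                     seq (multilinear f ⌜ x ⌝) k ≡ ext (λ R → seq (f R) k) (coord x)
seq-multilinear-⌜⌝ k f x = trans (seq-multilinear k f ⌜ x ⌝)
  (ext-cong (λ _ → refl) λ a → cong (λ t → seq t k) (pt-⌜⌝ x a))

vertex : Subset n → ℚCube n
vertex S = mkℚCube (χ S) (λ a → 0≤ (lookup S a)) (λ a → ≤1 (lookup S a))
  where
  0≤ : ∀ s → 0ℚ ℚ.≤ (if s then 1ℚ else 0ℚ)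
  0≤ true  = ℚₚ.<⇒≤ (ℚₚ.positive⁻¹ 1ℚ)
  0≤ false = ℚₚ.≤-refl
  ≤1 : ∀ s → (if s then 1ℚ else 0ℚ) ℚ.≤ 1ℚ
  ≤1 true  = ℚₚ.≤-refl
  ≤1 false = ℚₚ.<⇒≤ (ℚₚ.positive⁻¹ 1ℚ)

module _ (f : Subset n → ℝ) (F-C² : TwiceContinuouslyDifferentiable (multilinear f)) where
  open TwiceContinuouslyDifferentiable F-C²

  private
    φ : ℕ → Subset n → ℚ
    φ k R = seq (f R) k

  -- The gradient packaged in `F-C²` is an abstract witness; exact affineness along the axis
  -- identifies it. All rational points are covered, not just vertices, since the second derivative
  -- compares gradients along a segment.
  ∇-multilinear : ∀ x i → seq (∇ ⌜ x ⌝ i) ≃ λ k → ext (Δ i (φ k)) (coord x)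
  ∇-multilinear x i = partial-unique (multilinear f) i x (∇ ⌜ x ⌝ i)
    (λ k → ext (Δ i (φ k)) (coord x)) (∇-partial ⌜ x ⌝ i)
    λ y y≗x → ≗⇒≃ (increment y y≗x)
    where
    increment : ∀ y → (∀ a → a ≢ i → coord y a ≡ coord x a) → ∀ k →
      seq (multilinear f ⌜ y ⌝) k ℚ.- seq (multilinear f ⌜ x ⌝) k ≡
      (coord y i ℚ.- coord x i) ℚ.* ext (Δ i (φ k)) (coord x)
    increment y y≗x k = minus-≡
      {seq (multilinear f ⌜ y ⌝) k} {seq (multilinear f ⌜ x ⌝) k}
      {ext (φ k) (coord y)} {ext (φ k) (coord x)}
      (seq-multilinear-⌜⌝ k f y) (seq-multilinear-⌜⌝ k f x)
      (ext-affine (φ k) i {coord x} {coord y} y≗x)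

  -- The argument for the gradient is repeated one order higher. The values of `∇` are now known
  -- only up to `≃`, which is why `partial-unique` assumes affineness in that weak form.
  ∇²-multilinear : ∀ x i j → seq (∇² ⌜ x ⌝ i j) ≃ λ k → ext (Δ j (Δ i (φ k))) (coord x)
  ∇²-multilinear x i j = partial-unique (λ y → ∇ y i) j x (∇² ⌜ x ⌝ i j)
    (λ k → ext (Δ j (Δ i (φ k))) (coord x)) (∇²-partial ⌜ x ⌝ i j)
    λ y y≗x → ≃-trans
      (minus-cong-≃ (∇-multilinear y i) (∇-multilinear x i))
      (≗⇒≃ λ k → ext-affine (Δ i (φ k)) j y≗x)

  ∇-vertex : ∀ S i → seq (∇ ⌜ vertex S ⌝ i) ≃ λ k → Δ i (φ k) S
  ∇-vertex S i = ≃-trans (∇-multilinear (vertex S) i)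
    (≗⇒≃ λ k → ext-χ (Δ i (φ k)) S)

  ∇²-vertex : ∀ S i j → seq (∇² ⌜ vertex S ⌝ i j) ≃ λ k → Δ j (Δ i (φ k)) S
  ∇²-vertex S i j = ≃-trans (∇²-multilinear (vertex S) i j)
    (≗⇒≃ λ k → ext-χ (Δ j (Δ i (φ k))) S)

-- Second differences of set functions

+ₛ-≔ : (S : Subset n) (i : Fin n) → S +ₛ i ≡ S [ i ]≔ inside
+ₛ-≔ (s ∷ S) zero    = cong₂ _∷_ (∨-zeroʳ s) (∪-identityʳ S)
+ₛ-≔ (s ∷ S) (suc i) = cong₂ _∷_ (∨-identityʳ s) (+ₛ-≔ S i)

-ₛ-≔ : (S : Subset n) (i : Fin n) → S -ₛ i ≡ S [ i ]≔ outside
-ₛ-≔ (s ∷ S) zero    = cong (outside ∷_) (p─⊥≡p S)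
-ₛ-≔ (s ∷ S) (suc i) = cong (s ∷_) (-ₛ-≔ S i)

seq-B : ∀ k (f : Subset n → ℝ) i S → seq (B f i S) k ≡ Δ i (λ R → seq (f R) k) S
seq-B k f i S rewrite +ₛ-≔ S i | -ₛ-≔ S i = refl

seq-A : ∀ k (f : Subset n → ℝ) i j S → seq (A f i j S) k ≡ Δ i (Δ j λ R → seq (f R) k) S
seq-A k f i j S
  rewrite +ₛ-≔ S i | -ₛ-≔ S i
        | +ₛ-≔ (S [ i ]≔ inside) j | -ₛ-≔ (S [ i ]≔ inside) j
        | +ₛ-≔ (S [ i ]≔ outside) j | -ₛ-≔ (S [ i ]≔ outside) j = refl

-- The inner update overwrites the outer one at the same position, so the two inner differences
-- coincide. This is the vanishing of the pure second derivatives.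
Δ-diagonal : (φ : Subset n → ℚ) (i : Fin n) (S : Subset n) →
             Δ i (Δ i φ) S ≡ 0ℚ
Δ-diagonal φ i S
  rewrite []≔-idempotent {x = inside} {y = inside} S i
        | []≔-idempotent {x = inside} {y = outside} S i
        | []≔-idempotent {x = outside} {y = inside} S i
        | []≔-idempotent {x = outside} {y = outside} S i
  = ℚₚ.+-inverseʳ (φ (S [ i ]≔ inside) ℚ.- φ (S [ i ]≔ outside))

-- Updates at distinct positions commute, so both sides are the same signed sum of four values of
-- `φ`.
Δ-comm : (φ : Subset n → ℚ) (i j : Fin n) (S : Subset n) →
         Δ i (Δ j φ) S ≡ Δ j (Δ i φ) S
Δ-comm φ i j S with i Finₚ.≟ j
... | yes refl = refl
... | no  i≢j
  rewrite []≔-commutes {x = inside} {y = inside} S i j i≢j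
        | []≔-commutes {x = inside} {y = outside} S i j i≢j
        | []≔-commutes {x = outside} {y = inside} S i j i≢j
        | []≔-commutes {x = outside} {y = outside} S i j i≢j
  = solve 4 (λ a b c d → a :- b :- (c :- d) := a :- c :- (b :- d)) refl
      (φ (S [ j ]≔ inside [ i ]≔ inside)) (φ (S [ j ]≔ outside [ i ]≔ inside))
      (φ (S [ j ]≔ inside [ i ]≔ outside)) (φ (S [ j ]≔ outside [ i ]≔ outside))
  where open +-*-Solver

-- Finite sums, norms and the direction `u`

seq-sum : ∀ k (x : Fin n → ℝ) → seq (sum x) k ≡ ∑ λ a → seq (x a) k
seq-sum {ℕ.zero}  k x = refl
seq-sum {ℕ.suc n} k x = cong (seq (x zero) k ℚ.+_) (seq-sum k (x ∘ suc))

-- The Kronecker symbol, by recursion on both indices so that sums against it collapse by induction.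
δ : Fin n → Fin n → ℚ
δ zero    zero    = 1ℚ
δ zero    (suc _) = 0ℚ
δ (suc _) zero    = 0ℚ
δ (suc i) (suc a) = δ i a

0≤δ : (i a : Fin n) → 0ℚ ℚ.≤ δ i a
0≤δ zero    zero    = ℚₚ.<⇒≤ (ℚₚ.positive⁻¹ 1ℚ)
0≤δ zero    (suc _) = ℚₚ.≤-refl
0≤δ (suc _) zero    = ℚₚ.≤-refl
0≤δ (suc i) (suc a) = 0≤δ i a

δ≤1 : (i a : Fin n) → δ i a ℚ.≤ 1ℚ
δ≤1 zero    zero    = ℚₚ.≤-refl
δ≤1 zero    (suc _) = ℚₚ.<⇒≤ (ℚₚ.positive⁻¹ 1ℚ)
δ≤1 (suc _) zero    = ℚₚ.<⇒≤ (ℚₚ.positive⁻¹ 1ℚ)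
δ≤1 (suc i) (suc a) = δ≤1 i a

∑-δ : (i : Fin n) (g : Fin n → ℚ) → (∑ λ a → δ i a ℚ.* g a) ≡ g i
∑-δ {ℕ.suc n} zero g = trans
  (cong₂ ℚ._+_ (ℚₚ.*-identityˡ (g zero))
    (trans (sum-cong-≗ (ℚₚ.*-zeroˡ ∘ g ∘ suc)) (sum-replicate-zero n)))
  (ℚₚ.+-identityʳ (g zero))
∑-δ (suc i) g = trans
  (cong₂ ℚ._+_ (ℚₚ.*-zeroˡ (g zero)) (∑-δ i (g ∘ suc)))
  (ℚₚ.+-identityˡ (g (suc i)))

midpoint : Fin n → Fin n → ℚCube n
midpoint i j = mkℚCube (λ a → ℚ.½ ℚ.* (δ i a ℚ.+ δ j a))
  -- The required bounds 0 and 1 are the computed values of `½ * (0 + 0)` and `½ * (1 + 1)`.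
  (λ a → ℚₚ.*-monoˡ-≤-nonNeg ℚ.½ (ℚₚ.+-mono-≤ (0≤δ i a) (0≤δ j a)))
  (λ a → ℚₚ.*-monoˡ-≤-nonNeg ℚ.½ (ℚₚ.+-mono-≤ (δ≤1 i a) (δ≤1 j a)))

∑-midpoint : (i j : Fin n) (g : Fin n → ℚ) →
             (∑ λ a → coord (midpoint i j) a ℚ.* g a) ≡ ℚ.½ ℚ.* (g i ℚ.+ g j)
∑-midpoint i j g = begin
  (∑ λ a → ℚ.½ ℚ.* (δ i a ℚ.+ δ j a) ℚ.* g a)
    ≡⟨ sum-cong-≗ (λ a → solve 3 (λ x y g → con ℚ.½ :* (x :+ y) :* g :=
                                            con ℚ.½ :* (x :* g :+ y :* g))
                           refl (δ i a) (δ j a) (g a)) ⟩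
  (∑ λ a → ℚ.½ ℚ.* (δ i a ℚ.* g a ℚ.+ δ j a ℚ.* g a))
    ≡⟨ *-distribˡ-sum ℚ.½ (λ a → δ i a ℚ.* g a ℚ.+ δ j a ℚ.* g a) ⟨
  ℚ.½ ℚ.* (∑ λ a → δ i a ℚ.* g a ℚ.+ δ j a ℚ.* g a)
    ≡⟨ cong (ℚ.½ ℚ.*_) (∑-distrib-+ (λ a → δ i a ℚ.* g a) (λ a → δ j a ℚ.* g a)) ⟩
  ℚ.½ ℚ.* ((∑ λ a → δ i a ℚ.* g a) ℚ.+ (∑ λ a → δ j a ℚ.* g a))
    ≡⟨ cong (ℚ.½ ℚ.*_) (cong₂ ℚ._+_ (∑-δ i g) (∑-δ j g)) ⟩
  ℚ.½ ℚ.* (g i ℚ.+ g j) ∎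
  where
  open ≡-Reasoning
  open +-*-Solver

∑-∑-midpoint : (i j : Fin n) (h : Fin n → Fin n → ℚ) → let u = coord (midpoint i j) in
               (∑ λ a → ∑ λ b → u a ℚ.* h a b ℚ.* u b) ≡
               ℚ.½ ℚ.* (ℚ.½ ℚ.* (h i i ℚ.+ h i j) ℚ.+ ℚ.½ ℚ.* (h j i ℚ.+ h j j))
∑-∑-midpoint i j h = begin
  (∑ λ a → ∑ λ b → u a ℚ.* h a b ℚ.* u b)
    ≡⟨ sum-cong-≗ (λ a → sum-cong-≗ λ b → ℚₚ.*-comm (u a ℚ.* h a b) (u b)) ⟩
  (∑ λ a → ∑ λ b → u b ℚ.* (u a ℚ.* h a b))
    ≡⟨ sum-cong-≗ (λ a → ∑-midpoint i j (λ b → u a ℚ.* h a b)) ⟩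
  (∑ λ a → ℚ.½ ℚ.* (u a ℚ.* h a i ℚ.+ u a ℚ.* h a j))
    ≡⟨ sum-cong-≗ (λ a → solve 3 (λ u p q → con ℚ.½ :* (u :* p :+ u :* q) :=
                                            u :* (con ℚ.½ :* (p :+ q)))
                           refl (u a) (h a i) (h a j)) ⟩
  (∑ λ a → u a ℚ.* (ℚ.½ ℚ.* (h a i ℚ.+ h a j)))
    ≡⟨ ∑-midpoint i j (λ a → ℚ.½ ℚ.* (h a i ℚ.+ h a j)) ⟩
  _ ∎
  where
  open ≡-Reasoning
  open +-*-Solver
  u = coord (midpoint i j)

seq-‖‖₁ : ∀ k (x : ℚCube n) → seq ‖ pt ⌜ x ⌝ ‖₁ k ≡ ∑ (coord x)
seq-‖‖₁ k x = trans (seq-sum k (∣_∣ ∘ pt ⌜ x ⌝)) (sum-cong-≗ λ a →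
  trans (cong (λ t → ℚ.∣ seq t k ∣) (pt-⌜⌝ x a)) (ℚₚ.0≤p⇒∣p∣≡p (0≤coord x a)))

1+fromℕ : ∀ m → 1ℚ ℚ.+ + m ℚ./ 1 ≡ + ℕ.suc m ℚ./ 1
1+fromℕ m = trans
  -- The gcd hidden in `+ m / 1` does not reduce for a variable `m`; coprimality with 1 exposes the
  -- normal form, after which the addition computes.
  (cong (1ℚ ℚ.+_) (ℚₚ.normalize-coprime (Coprimality.sym (Coprimality.1-coprimeTo m))))
  (ℚₚ./-cong (cong (ℤ._+_ (+ 1)) (ℤₚ.*-identityʳ (+ m))) refl)

∑-χ : (S : Subset n) → ∑ (χ S) ≡ + Subset.∣ S ∣ ℚ./ 1
∑-χ []            = refl
∑-χ (inside  ∷ S) = trans (cong (1ℚ ℚ.+_) (∑-χ S)) (1+fromℕ Subset.∣ S ∣)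
∑-χ (outside ∷ S) = trans (ℚₚ.+-identityˡ _) (∑-χ S)

∑-midpoint≡1 : (i j : Fin n) → ∑ (coord (midpoint i j)) ≡ 1ℚ
∑-midpoint≡1 i j = trans
  (sum-cong-≗ λ a → sym (ℚₚ.*-identityʳ (coord (midpoint i j) a)))
  (∑-midpoint i j λ _ → 1ℚ)

seq-gradient : ∀ k (u : ℚCube n) (g : Fin n → ℝ) →
  seq (sum λ a → pt ⌜ u ⌝ a * g a) k ≡ ∑ λ a → coord u a ℚ.* seq (g a) k
seq-gradient k u g = trans (seq-sum k λ a → pt ⌜ u ⌝ a * g a)
  (sum-cong-≗ λ a → cong (λ t → seq (t * g a) k) (pt-⌜⌝ u a))

seq-hessian : ∀ k (u : ℚCube n) (h : Fin n → Fin n → ℝ) →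
  seq (sum λ a → sum λ b → pt ⌜ u ⌝ a * h a b * pt ⌜ u ⌝ b) k ≡
  (∑ λ a → ∑ λ b → coord u a ℚ.* seq (h a b) k ℚ.* coord u b)
seq-hessian k u h = trans
  (seq-sum k λ a → sum λ b → pt ⌜ u ⌝ a * h a b * pt ⌜ u ⌝ b)
  (sum-cong-≗ λ a → trans
    (seq-sum k λ b → pt ⌜ u ⌝ a * h a b * pt ⌜ u ⌝ b)
    (sum-cong-≗ λ b → cong₂ (λ s t → seq (s * h a b * t) k) (pt-⌜⌝ u a) (pt-⌜⌝ u b)))

-- Smoothness at a vertex

vertex#0⃗ : {S : Subset n} → Nonempty S → pt ⌜ vertex S ⌝ #0⃗
vertex#0⃗ {S = S} (i , i∈S) = i , subst (_# 0ℝ)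
  (sym (trans (pt-⌜⌝ (vertex S) i)
    (cong (λ s → fromℚ (if s then 1ℚ else 0ℚ)) ([]=⇒lookup i∈S))))
  (1ℚ , ℚₚ.positive⁻¹ 1ℚ , 0 , λ _ _ → ℚₚ.≤-refl)

¼ : ℚ
¼ = ℚ.½ ℚ.* ℚ.½

¼-cancel-≤ : ∀ {x y x′ y′ : ℝ} → seq x ≃ (λ k → ¼ ℚ.* seq x′ k) → seq y ≃ (λ k → ¼ ℚ.* seq y′ k) →
             x ≤ y → x′ ≤ y′
¼-cancel-≤ {x} {y} {x′} {y′} x≃ y≃ x≤y ε 0<ε =
  -- The scaled inequality is used with error `¼ * ε`, which becomes `ε` once the factor is
  -- cancelled.
  let N , p = ≤-resp-≃ {x} {fromℚ ¼ * x′} {y} {fromℚ ¼ * y′} x≃ y≃ x≤y (¼ ℚ.* ε)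
                (0<pq (ℚₚ.positive⁻¹ ¼) 0<ε)
  in N , λ k N≤k → ℚₚ.*-cancelˡ-≤-pos ¼
    (subst (¼ ℚ.* seq x′ k ℚ.≤_) (sym (ℚₚ.*-distribˡ-+ ¼ (seq y′ k) ε)) (p k N≤k))

-- The diagonal entries drop out and the two mixed ones add up to `2m`. With weight ¼ from `u` on
-- each entry and the ½ of the smoothness inequality this leaves a quarter of `m`.
quarter-hessian : {h₁ h₂ h₃ h₄ m : ℕ → ℚ} →
  h₁ ≃ (λ _ → 0ℚ) → h₂ ≃ m → h₃ ≃ m → h₄ ≃ (λ _ → 0ℚ) →
  (λ k → ℚ.½ ℚ.* (ℚ.½ ℚ.* (ℚ.½ ℚ.* (h₁ k ℚ.+ h₂ k) ℚ.+ ℚ.½ ℚ.* (h₃ k ℚ.+ h₄ k)))) ≃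
  λ k → ¼ ℚ.* m k
quarter-hessian {h₁} {h₂} {h₃} {h₄} {m} h₁≃0 h₂≃m h₃≃m h₄≃0 = ≃-trans
  {v = λ k → ℚ.½ ℚ.* ¼ ℚ.* ((h₁ k ℚ.+ h₂ k) ℚ.+ (h₃ k ℚ.+ h₄ k))}
  (≗⇒≃ λ k → solve 4 (λ a b c d →
    con ℚ.½ :* (con ℚ.½ :* (con ℚ.½ :* (a :+ b) :+ con ℚ.½ :* (c :+ d))) :=
    con (ℚ.½ ℚ.* ¼) :* ((a :+ b) :+ (c :+ d))) refl (h₁ k) (h₂ k) (h₃ k) (h₄ k))
  (≃-trans {v = λ k → ℚ.½ ℚ.* ¼ ℚ.* ((0ℚ ℚ.+ m k) ℚ.+ (m k ℚ.+ 0ℚ))}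
    (*-congˡ-≃ (fromℚ (ℚ.½ ℚ.* ¼)) (+-cong-≃ (+-cong-≃ h₁≃0 h₂≃m) (+-cong-≃ h₃≃m h₄≃0)))
    (≗⇒≃ λ k → solve 1 (λ m →
      con (ℚ.½ ℚ.* ¼) :* ((con 0ℚ :+ m) :+ (m :+ con 0ℚ)) := con ¼ :* m) refl (m k)))
  where open +-*-Solver

-- One factor ½ comes from the smoothness constant `½ * γ`, the other from `u`; `r` stands for the
-- inverse of the size of the set.
quarter-gradient : (γ : ℝ) (r : ℚ) {g₁ g₂ b₁ b₂ : ℕ → ℚ} → g₁ ≃ b₁ → g₂ ≃ b₂ →
  (λ k → ℚ.½ ℚ.* seq γ k ℚ.* r ℚ.* (ℚ.½ ℚ.* (g₁ k ℚ.+ g₂ k))) ≃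
  λ k → ¼ ℚ.* (seq γ k ℚ.* ((b₁ k ℚ.+ b₂ k) ℚ.* r))
quarter-gradient γ r {g₁} {g₂} {b₁} {b₂} g₁≃b₁ g₂≃b₂ = ≃-trans
  {v = λ k → ℚ.½ ℚ.* seq γ k ℚ.* r ℚ.* (ℚ.½ ℚ.* (b₁ k ℚ.+ b₂ k))}
  (*-congˡ-≃ (½ * γ * fromℚ r) (*-congˡ-≃ ½ (+-cong-≃ g₁≃b₁ g₂≃b₂)))
  (≗⇒≃ λ k → solve 4 (λ γ r p q → con ℚ.½ :* γ :* r :* (con ℚ.½ :* (p :+ q)) :=
                                  con ¼ :* (γ :* ((p :+ q) :* r)))
    refl (seq γ k) r (b₁ k) (b₂ k))
  where open +-*-Solver

proposition1 : (n : ℕ) (γ : ℝ) → 0ℝ ≤ γ → (f : Subset n → ℝ) →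
    OneSidedSmooth (½ * γ) (multilinear f) → MetaSubmodular γ f
proposition1 n γ _ f (F-C² , smooth) S S≢∅ i j =
  ¼-cancel-≤ {½ * uᵀ∇²u} {½ * γ * ratio * uᵀ∇} {A f i j S}
    {γ * ((B f i S + B f j S) / fromℕ Subset.∣ S ∣ ⟨ nonempty⇒∣∣#0 S≢∅ ⟩)}
    hessian gradient (smooth ⌜ vertex S ⌝ (vertex#0⃗ S≢∅) ⌜ u ⌝)
  where
  open TwiceContinuouslyDifferentiable F-C²

  u : ℚCube n
  u = midpoint i j

  φ : ℕ → Subset n → ℚ
  φ k R = seq (f R) k

  -- Since `recip` inverts each term by `inv`, dividing by the norm of the vertex and dividing by
  -- the cardinality of `S` both become multiplication by this one rational.
  size⁻¹ : ℚ
  size⁻¹ = inv (+ Subset.∣ S ∣ ℚ./ 1)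

  ratio uᵀ∇ uᵀ∇²u : ℝ
  ratio = ‖ pt ⌜ u ⌝ ‖₁ / ‖ pt ⌜ vertex S ⌝ ‖₁ ⟨ #0⃗⇒‖‖₁#0 (pt ⌜ vertex S ⌝) (vertex#0⃗ S≢∅) ⟩
  uᵀ∇   = sum λ a → pt ⌜ u ⌝ a * ∇ ⌜ vertex S ⌝ a
  uᵀ∇²u = sum λ a → sum λ b → pt ⌜ u ⌝ a * ∇² ⌜ vertex S ⌝ a b * pt ⌜ u ⌝ b

  seq-ratio : ∀ k → seq ratio k ≡ size⁻¹
  seq-ratio k = trans
    (cong₂ (λ s t → s ℚ.* inv t)
      (trans (seq-‖‖₁ k u) (∑-midpoint≡1 i j))
      (trans (seq-‖‖₁ k (vertex S)) (∑-χ S)))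
    (ℚₚ.*-identityˡ size⁻¹)

  ∇²-limit : ∀ a b → (∀ k → Δ b (Δ a (φ k)) S ≡ seq (A f i j S) k) →
             seq (∇² ⌜ vertex S ⌝ a b) ≃ seq (A f i j S)
  ∇²-limit a b Δ≡A = ≃-trans (∇²-vertex f F-C² S a b) (≗⇒≃ Δ≡A)

  ∇²-diagonal : ∀ a → seq (∇² ⌜ vertex S ⌝ a a) ≃ λ _ → 0ℚ
  ∇²-diagonal a = ≃-trans (∇²-vertex f F-C² S a a) (≗⇒≃ λ k → Δ-diagonal (φ k) a S)

  hessian : seq (½ * uᵀ∇²u) ≃ λ k → ¼ ℚ.* seq (A f i j S) k
  hessian = ≃-trans
    (≗⇒≃ λ k → cong (ℚ.½ ℚ.*_) (trans
      (seq-hessian k u (∇² ⌜ vertex S ⌝))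
      (∑-∑-midpoint i j λ a b → seq (∇² ⌜ vertex S ⌝ a b) k)))
    (quarter-hessian
      {λ k → seq (∇² ⌜ vertex S ⌝ i i) k} {λ k → seq (∇² ⌜ vertex S ⌝ i j) k}
      {λ k → seq (∇² ⌜ vertex S ⌝ j i) k} {λ k → seq (∇² ⌜ vertex S ⌝ j j) k}
      {λ k → seq (A f i j S) k}
      (∇²-diagonal i)
      -- The Hessian entry at `i`, `j` takes its outer difference in `j`, whereas `A f i j` takes it
      -- in `i`; only this entry calls for the exchange.
      (∇²-limit i j λ k → trans (Δ-comm (φ k) j i S) (sym (seq-A k f i j S)))
      (∇²-limit j i λ k → sym (seq-A k f i j S))
      (∇²-diagonal j))

  ∇-limit : ∀ a → seq (∇ ⌜ vertex S ⌝ a) ≃ seq (B f a S)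
  ∇-limit a = ≃-trans (∇-vertex f F-C² S a) (≗⇒≃ λ k → sym (seq-B k f a S))

  gradient : seq (½ * γ * ratio * uᵀ∇) ≃
             λ k → ¼ ℚ.* (seq γ k ℚ.* ((seq (B f i S) k ℚ.+ seq (B f j S) k) ℚ.* size⁻¹))
  gradient = ≃-trans
    (≗⇒≃ λ k → cong₂ (λ s t → ℚ.½ ℚ.* seq γ k ℚ.* s ℚ.* t) (seq-ratio k) (trans
      (seq-gradient k u (∇ ⌜ vertex S ⌝))
      (∑-midpoint i j λ a → seq (∇ ⌜ vertex S ⌝ a) k)))
    (quarter-gradient γ size⁻¹
      {λ k → seq (∇ ⌜ vertex S ⌝ i) k} {λ k → seq (∇ ⌜ vertex S ⌝ j) k}
      {λ k → seq (B f i S) k} {λ k → seq (B f j S) k} (∇-limit i) (∇-limit j))
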